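{- Let $k\geq 3$ be an integer and let $G$ be a $k$-regular bipartite graph with bipartition $(X,Y)$. Then $G$ contains a 1-anti-factor, i.e., a spanning subgraph $F$ of $G$ such that $d_F(x)=1$ for every $x\in X$ and $d_F(y)\neq 1$ for every $y\in Y$.
   Context: Graphs are finite, simple and undirected. $d_F(v)$ denotes the degree of $v$ in the subgraph $F$. -}

module Defs where

open import Data.Nat using (ℕ; _+_)
open import Data.Bool using (Bool; true; false; T; T?)
open import Data.Fin using (Fin)
open import Data.List using (List; filter; length; allFin)
open import Data.Product using (Σ; _×_)
open import Relation.Nullary using (¬_)
open import Relation.Binary.PropositionalEquality using (_≡_)

-- A finite simple bipartite graph with bipartition (X , Y), X = Fin m, Y = Fin n.
-- Edges only go between X and Y; simple = at most one edge per pair,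
-- encoded by a Boolean adjacency relation.
record BipGraph (m n : ℕ) : Set where
  field
    adj : Fin m → Fin n → Bool
open BipGraph public

countTrue : ∀ {n} → (Fin n → Bool) → ℕ
countTrue {n} p = length (filter (λ i → T? (p i)) (allFin n))

degX : ∀ {m n} → (Fin m → Fin n → Bool) → Fin m → ℕ
degX e x = countTrue (λ y → e x y)

degY : ∀ {m n} → (Fin m → Fin n → Bool) → Fin n → ℕ
degY e y = countTrue (λ x → e x y)

Regular : ∀ {m n} → ℕ → BipGraph m n → Set
Regular k G = (∀ x → degX (adj G) x ≡ k) × (∀ y → degY (adj G) y ≡ k)

SpanningSubgraph : ∀ {m n} → BipGraph m n → Set
SpanningSubgraph {m} {n} G =
  Σ (Fin m → Fin n → Bool) (λ f → ∀ x y → T (f x y) → T (adj G x y))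

IsOneAntiFactor : ∀ {m n} → (Fin m → Fin n → Bool) → Set
IsOneAntiFactor f = (∀ x → degX f x ≡ 1) × (∀ y → ¬ (degY f y ≡ 1))

{-# OPTIONS --safe #-}
module Submission where

-- A regular bipartite graph has a selection φ of neighbours that covers Y. Put an arc u → v when u is
-- adjacent to φ v: a 1-anti-factor is then a map g sending every vertex to itself or along an arc, none
-- of whose fibres is a singleton, and since k ≥ 3 every vertex u has an arc to a vertex outside {u , a}
-- for each a.
--
-- If every vertex reaches r, and r is promised an extra preimage, process the vertices of an in-tree
-- towards r from the leaves on: a vertex that was chosen before chooses itself, the others pass to their
-- parent. So in a strongly connected digraph it is enough to find an arc c → r such that all vertices
-- other than c reach r avoiding c: then c supplies the extra preimage of r and is itself never chosen.
-- In general, treat the terminal strong components this way and pass tokens towards them from outside; a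
-- component that receives a token takes its receiver as root instead.
--
-- Such an arc is one maximising the set B of vertices reaching r avoiding c. If u ∉ B ∪ {c}, follow arcs
-- u → t with t ≠ c; these stay outside B ∪ {c}. If r reaches t avoiding u, then (u , t) beats (c , r).
-- Otherwise everything r reaches avoiding u, and u itself, is reached from r avoiding t, so the set
-- reached from r avoiding the current vertex grows, and this happens only finitely often.

open import Defs
open import Data.Bool using (Bool; true; false; T; T?)
open import Data.Fin using (Fin; zero; suc)
open import Data.Fin.Properties using (_≟_; any?)
open import Data.Fin.Subset using (Subset; _∈_; _∉_; _⊆_; _⊂_; _∪_; ⁅_⁆; ⊥; Nonempty)
open import Data.Fin.Subset.Induction using (⊂-wellFounded; ⊃-wellFounded; Acc; acc)
open import Data.Fin.Subset.Properties
  using (_∈?_; x∈⁅x⁆; x∈⁅y⁆⇒x≡y; p⊆p∪q; q⊆p∪q; x∈p∪q⁻; ⊆-antisym; ∉⊥)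
open import Data.List using (length; filter; tabulate; allFin; []; _∷_)
open import Data.List.Membership.Propositional using () renaming (_∈_ to _∈ₗ_)
open import Data.List.Membership.Propositional.Properties using (∈-filter⁺; ∈-allFin)
open import Data.List.Relation.Unary.Any using (here)
open import Data.Nat using (ℕ; zero; suc; NonZero; _+_; _*_; _≤_; _<_; _≥_; z≤n; s≤s; >-nonZero⁻¹)
open import Data.Nat.Properties hiding (_≟_)
open import Data.Product using (Σ; ∃; ∃₂; _×_; _,_; proj₁; proj₂)
open import Data.Sum using (_⊎_; inj₁; inj₂; map₂; [_,_]′)
open import Data.Vec as Vec using ()
open import Data.Vec.Functional using (updateAt)
open import Data.Vec.Functional.Properties using (updateAt-updates; updateAt-minimal)
open import Data.Vec.Properties using (lookup∘tabulate; []=⇒lookup; lookup⇒[]=)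
open import Function using (_∘_; flip)
open import Level using (0ℓ)
open import Relation.Binary using (Rel; Decidable)
open import Relation.Binary.Construct.Closure.ReflexiveTransitive using (Star; ε; _◅_; _◅◅_)
open import Relation.Binary.PropositionalEquality using (_≡_; _≢_; refl; sym; trans; cong; cong₂; subst)
open import Relation.Nullary using (Dec; yes; no; does; ¬?; ¬_; contradiction; _×-dec_)
open import Relation.Nullary.Decidable using (dec-true; dec-false)
open import Relation.Unary using (Pred) renaming (Decidable to Decidable₁)
open import Algebra.Properties.Semiring.Sum +-*-semiring
  using (sum; ∑-comm; ∑-distrib-+; sum-cong-≗; *-distribˡ-sum)

-- Reachability

private variable
  n : ℕ

x∈p∪⁅x⁆ : ∀ (A : Subset n) x → x ∈ A ∪ ⁅ x ⁆
x∈p∪⁅x⁆ A x = q⊆p∪q A ⁅ x ⁆ (x∈⁅x⁆ x)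

x∈p∪⁅y⁆⁻ : ∀ (A : Subset n) {x y} → x ∈ A ∪ ⁅ y ⁆ → x ∈ A ⊎ x ≡ y
x∈p∪⁅y⁆⁻ A {y = y} = map₂ (x∈⁅y⁆⇒x≡y y) ∘ x∈p∪q⁻ A ⁅ y ⁆

∈-∉⇒≢ : ∀ {A : Subset n} {x y} → x ∈ A → y ∉ A → x ≢ y
∈-∉⇒≢ x∈A y∉A refl = y∉A x∈A

∪⁅⁆-⊃ : ∀ {A : Subset n} {x} → x ∉ A → A ⊂ A ∪ ⁅ x ⁆
∪⁅⁆-⊃ {A = A} {x} x∉A = p⊆p∪q ⁅ x ⁆ , x , x∈p∪⁅x⁆ A x , x∉A

Closed : Rel (Fin n) 0ℓ → Subset n → Set
Closed E A = ∀ {u v} → u ∈ A → E u v → v ∈ A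

-- A derivation records a search tree: each `extend` adds a new leaf `v` below `u`. With `flip E` it
-- is an in-tree towards `s`, and recursion on it meets the leaves first.
data Grown {n} (E : Rel (Fin n) 0ℓ) (s : Fin n) : Subset n → Set where
  source : Grown E s ⁅ s ⁆
  extend : ∀ {A u v} → Grown E s A → u ∈ A → v ∉ A → E u v → Grown E s (A ∪ ⁅ v ⁆)

module _ {E : Rel (Fin n) 0ℓ} where

  grown-source : ∀ {s A} → Grown E s A → s ∈ A
  grown-source {s} source = x∈⁅x⁆ s
  grown-source (extend g _ _ _) = p⊆p∪q _ (grown-source g)

  -- The step also receives that both ends lie in `A`, which shows that the tree arcs miss any
  -- vertex outside `A`.
  grown-ind : ∀ {s A} (P : Fin n → Set) → Grown E s A → P s →
              (∀ {u v} → u ∈ A → v ∈ A → P u → E u v → P v) → ∀ {v} → v ∈ A → P v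
  grown-ind P source Ps step v∈ = subst P (sym (x∈⁅y⁆⇒x≡y _ v∈)) Ps
  grown-ind P (extend {A} {u} {w} g u∈A w∉A Euw) Ps step {v} v∈
    with ih ← (λ {x} → grown-ind P g Ps (λ a∈ b∈ → step (p⊆p∪q _ a∈) (p⊆p∪q _ b∈)) {x})
    with x∈p∪⁅y⁆⁻ A v∈
  ... | inj₁ v∈A = ih v∈A
  ... | inj₂ refl = step (p⊆p∪q _ u∈A) (x∈p∪⁅x⁆ A w) (ih u∈A) Euw

  closed-star : ∀ {A u v} → Closed E A → u ∈ A → Star E u v → v ∈ A
  closed-star cl u∈A ε = u∈A
  closed-star cl u∈A (e ◅ es) = closed-star cl (cl u∈A e) es

  closed-star⁻ : ∀ {A u v} → Closed (flip E) A → v ∈ A → Star E u v → u ∈ A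
  closed-star⁻ cl v∈A ε = v∈A
  closed-star⁻ cl v∈A (e ◅ es) = cl (closed-star⁻ cl v∈A es) e

  module _ (E? : Decidable E) where

    closed? : ∀ A → (∃₂ λ u v → u ∈ A × v ∉ A × E u v) ⊎ Closed E A
    closed? A with any? (λ u → any? (λ v → u ∈? A ×-dec ¬? (v ∈? A) ×-dec E? u v))
    ... | yes exit = inj₁ exit
    ... | no ¬exit = inj₂ λ {u} {v} u∈A Euv → cl u v u∈A Euv
      where
      cl : ∀ u v → u ∈ A → E u v → v ∈ A
      cl u v u∈A Euv with v ∈? A
      ... | yes v∈A = v∈A
      ... | no v∉A = contradiction (u , v , u∈A , v∉A , Euv) ¬exit

    saturate : ∀ {s A} → Acc (flip _⊂_) A → Grown E s A → ∃ λ B → Grown E s B × Closed E B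
    saturate {A = A} (acc rec) g with closed? A
    ... | inj₂ cl = A , g , cl
    ... | inj₁ (u , v , u∈A , v∉A , Euv) = saturate (rec (∪⁅⁆-⊃ v∉A)) (extend g u∈A v∉A Euv)

    reach : Fin n → Subset n
    reach s = proj₁ (saturate {s} (⊃-wellFounded _) source)

    reach-grown : ∀ s → Grown E s (reach s)
    reach-grown s = proj₁ (proj₂ (saturate {s} (⊃-wellFounded _) source))

    reach-closed : ∀ s → Closed E (reach s)
    reach-closed s = proj₂ (proj₂ (saturate {s} (⊃-wellFounded _) source))

    reach-source : ∀ s → s ∈ reach s
    reach-source s = grown-source (reach-grown s)

    reach-star : ∀ {s v} → v ∈ reach s → Star E s v
    reach-star {s} = grown-ind (Star E s) (reach-grown s) ε (λ _ _ p e → p ◅◅ e ◅ ε)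

infixl 6 _∖_
_∖_ : Rel (Fin n) 0ℓ → Fin n → Rel (Fin n) 0ℓ
(E ∖ c) u v = E u v × u ≢ c × v ≢ c

∖-dec : ∀ {E : Rel (Fin n) 0ℓ} → Decidable E → ∀ c → Decidable (E ∖ c)
∖-dec E? c u v = E? u v ×-dec ¬? (u ≟ c) ×-dec ¬? (v ≟ c)

grown-avoids : ∀ {E F : Rel (Fin n) 0ℓ} {c r A} → Grown E r A →
               (∀ {u v} → E u v → (F ∖ c) u v ⊎ (F ∖ c) v u) → r ≢ c → ∀ {v} → v ∈ A → v ≢ c
grown-avoids {c = c} g sub r≢c =
  grown-ind (_≢ c) g r≢c λ _ _ _ e → [ proj₂ ∘ proj₂ , proj₁ ∘ proj₂ ]′ (sub e)

-- Dominating arcs in a strongly connected digraph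

module Strong {E : Rel (Fin n) 0ℓ} (E? : Decidable E) (C : Subset n)
  (E⊆C : ∀ {u v} → E u v → u ∈ C × v ∈ C)
  (connected : ∀ {u v} → u ∈ C → v ∈ C → Star E u v)
  (branching : ∀ {u} → u ∈ C → ∀ a → ∃ λ t → E u t × t ≢ u × t ≢ a)
  where

  private
    into : Fin n → Fin n → Subset n
    into c r = reach (flip (∖-dec E? c)) r

    from : Fin n → Fin n → Subset n
    from c r = reach (∖-dec E? c) r

    into∪ : Fin n → Fin n → Subset n
    into∪ c r = into c r ∪ ⁅ c ⁆

    from-avoids : ∀ {c r} → r ≢ c → ∀ {v} → v ∈ from c r → v ≢ c
    from-avoids {c} {r} = grown-avoids (reach-grown (∖-dec E? c) r) inj₁

  module _ {c r} (Ecr : E c r) (r≢c : r ≢ c) where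

    -- A path to `r` inside `into c r` misses `u`, and `r` goes on to `t` avoiding `u`; `c` joins
    -- through the arc `c → r`. The gain is `u` itself.
    into-⊂ : ∀ {u t} → u ∉ into∪ c r → E u t → t ∈ from u r → into∪ c r ⊂ into∪ u t
    into-⊂ {u} {t} u∉ Eut t∈ = (λ v∈ → p⊆p∪q ⁅ u ⁆ (sub v∈)) , u , x∈p∪⁅x⁆ (into u t) u , u∉
      where
      closed : Closed (flip (E ∖ u)) (into u t)
      closed = reach-closed (flip (∖-dec E? u)) t
      u∉into : u ∉ into c r
      u∉into = u∉ ∘ p⊆p∪q ⁅ c ⁆
      r∈into : r ∈ into c r
      r∈into = reach-source (flip (∖-dec E? c)) r
      r≢u : r ≢ u
      r≢u = ∈-∉⇒≢ r∈into u∉into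
      r∈ : r ∈ into u t
      r∈ = closed-star⁻ closed (reach-source (flip (∖-dec E? u)) t) (reach-star (∖-dec E? u) t∈)
      sub : into∪ c r ⊆ into u t
      sub v∈ with x∈p∪⁅y⁆⁻ (into c r) v∈
      ... | inj₁ v∈into = grown-ind (_∈ into u t) (reach-grown (flip (∖-dec E? c)) r) r∈
              (λ p∈ w∈ p∈′ e → closed p∈′ (proj₁ e , ∈-∉⇒≢ w∈ u∉into , ∈-∉⇒≢ p∈ u∉into)) v∈into
      ... | inj₂ refl = closed r∈ (Ecr , ∈-∉⇒≢ (x∈p∪⁅x⁆ (into c r) c) u∉ , r≢u)

    -- What `r` reaches avoiding `u` does not include `t`, so it is also reached avoiding `t`. The
    -- gain is `u`.
    from-⊂ : ∀ {u t} → u ∈ C → r ≢ u → t ≢ u → t ∉ from u r → from u r ⊂ from t r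
    from-⊂ {u} {t} u∈C r≢u t≢u t∉ =
      sub , u , u∈ , λ u∈from → from-avoids r≢u u∈from refl
      where
      sub : from u r ⊆ from t r
      sub = grown-ind (_∈ from t r) (reach-grown (∖-dec E? u) r) (reach-source (∖-dec E? t) r)
        λ p∈ w∈ p∈′ e → reach-closed (∖-dec E? t) r p∈′ (proj₁ e , ∈-∉⇒≢ p∈ t∉ , ∈-∉⇒≢ w∈ t∉)
      -- Only the part of the walk up to its first visit to `u` is used; before that it stays in
      -- `from u r`, hence misses `t`.
      hit : ∀ {p} → p ∈ from u r → Star E p u → u ∈ from t r
      hit p∈ ε = sub p∈
      hit {p} p∈ (_◅_ {j = q} e es) with q ≟ u
      ... | yes refl = reach-closed (∖-dec E? t) r (sub p∈) (e , ∈-∉⇒≢ p∈ t∉ , t≢u ∘ sym)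
      ... | no q≢u = hit (reach-closed (∖-dec E? u) r p∈ (e , from-avoids r≢u p∈ , q≢u)) es
      u∈ : u ∈ from t r
      u∈ = hit (reach-source (∖-dec E? u) r) (connected (proj₂ (E⊆C Ecr)) u∈C)

    improve : ∀ {u} → Acc (flip _⊂_) (from u r) → u ∈ C → u ∉ into∪ c r →
              ∃₂ λ u′ t → E u′ t × t ≢ u′ × into∪ c r ⊂ into∪ u′ t
    improve {u} (acc rec) u∈C u∉ with branching u∈C c
    ... | t , Eut , t≢u , t≢c with t ∈? from u r
    ...   | yes t∈ = u , t , Eut , t≢u , into-⊂ u∉ Eut t∈
    ...   | no t∉ = improve (rec (from-⊂ u∈C r≢u t≢u t∉)) (proj₂ (E⊆C Eut)) t∉into∪
      where
      u∉into : u ∉ into c r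
      u∉into = u∉ ∘ p⊆p∪q ⁅ c ⁆
      r≢u : r ≢ u
      r≢u = ∈-∉⇒≢ (reach-source (flip (∖-dec E? c)) r) u∉into
      u≢c : u ≢ c
      u≢c refl = u∉ (x∈p∪⁅x⁆ (into c r) c)
      t∉into∪ : t ∉ into∪ c r
      t∉into∪ t∈ with x∈p∪⁅y⁆⁻ (into c r) t∈
      ... | inj₁ t∈into = u∉into (reach-closed (flip (∖-dec E? c)) r t∈into (Eut , u≢c , t≢c))
      ... | inj₂ t≡c = t≢c t≡c

  Dominating : Fin n → Fin n → Set
  Dominating c r = E c r × r ≢ c × C ⊆ into∪ c r

  maximise : ∀ {c r} → Acc (flip _⊂_) (into∪ c r) → E c r → r ≢ c → ∃₂ Dominating
  maximise {c} {r} (acc rec) Ecr r≢c with any? (λ u → u ∈? C ×-dec ¬? (u ∈? into∪ c r))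
  ... | yes (u , u∈C , u∉) =
    let u′ , t , e , t≢u′ , lt = improve Ecr r≢c (⊃-wellFounded _) u∈C u∉ in maximise (rec lt) e t≢u′
  ... | no ¬u = c , r , Ecr , r≢c , λ {v} v∈C → total v v∈C
    where
    total : ∀ v → v ∈ C → v ∈ into∪ c r
    total v v∈C with v ∈? into∪ c r
    ... | yes v∈ = v∈
    ... | no v∉ = contradiction (v , v∈C , v∉) ¬u

  dominating-arc : Nonempty C → ∃₂ Dominating
  dominating-arc (v , v∈C) =
    let t , e , t≢v , _ = branching v∈C v in maximise (⊃-wellFounded _) e t≢v

-- Maps without singleton fibres

redirect : ∀ {A : Set} → (Fin n → A) → Fin n → A → Fin n → A
redirect g w v = updateAt g w (λ _ → v)

redirect-at : ∀ {A : Set} (g : Fin n → A) w v → redirect g w v w ≡ v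
redirect-at g w v = updateAt-updates w g

redirect-off : ∀ {A : Set} (g : Fin n → A) {w x} v → x ≢ w → redirect g w v x ≡ g x
redirect-off g v x≢w = updateAt-minimal _ _ g x≢w

-- The vertices of T hold a token from outside A, that is, an extra preimage; the move on A must leave
-- no fibre that is a singleton when tokens are counted, and a token holder stays put.
record Settled (E : Rel (Fin n) 0ℓ) (T A : Subset n) : Set where
  field
    move : Fin n → Fin n
    move-∈ : ∀ {x} → x ∈ A → move x ∈ A
    along : ∀ {x} → x ∈ A → move x ≡ x ⊎ E x (move x)
    token-stays : ∀ {x} → x ∈ A → x ∈ T → move x ≡ x
    shared : ∀ {x} → x ∈ A → move x ∈ T ⊎ ∃ λ x′ → x′ ∈ A × x′ ≢ x × move x′ ≡ move x

open Settled

module _ {E : Rel (Fin n) 0ℓ} {T A : Subset n} {w : Fin n} (w∉A : w ∉ A) where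

  private
    case-∪ : ∀ {P : Fin n → Set} → (∀ {x} → x ∈ A → P x) → P w → ∀ {x} → x ∈ A ∪ ⁅ w ⁆ → P x
    case-∪ {P} on-A on-w x∈ = [ on-A , (λ x≡w → subst P (sym x≡w) on-w) ]′ (x∈p∪⁅y⁆⁻ A x∈)

    old : ∀ {x} → x ∈ A → x ∈ A ∪ ⁅ w ⁆
    old = p⊆p∪q ⁅ w ⁆

  module _ (v : Fin n) {T′ : Subset n} (S : Settled E T′ A) where

    private
      g : Fin n → Fin n
      g = redirect (move S) w v

      g-w : g w ≡ v
      g-w = redirect-at (move S) w v

      g-A : ∀ {x} → x ∈ A → g x ≡ move S x
      g-A x∈A = redirect-off (move S) v (∈-∉⇒≢ x∈A w∉A)

    -- Common form of the two ways to add `w`: a fibre of `A` that relied on a token in `T′` but not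
    -- in `T` must now get its extra preimage from `w`.
    extend-settled :
      v ∈ A ∪ ⁅ w ⁆ → v ≡ w ⊎ E w v → (w ∈ T → v ≡ w) → (∀ {x} → x ∈ T → x ∈ T′) →
      (∀ {x} → x ∈ A → move S x ∈ T′ → move S x ∈ T ⊎ v ≡ move S x) →
      v ∈ T ⊎ (∃ λ x → x ∈ A × move S x ≡ v) →
      Settled E T (A ∪ ⁅ w ⁆)
    extend-settled v∈ arc stays T⊆T′ shared-A shared-w = record
      { move = g
      ; move-∈ = case-∪ (λ x∈ → subst (_∈ A ∪ ⁅ w ⁆) (sym (g-A x∈)) (old (move-∈ S x∈)))
                        (subst (_∈ A ∪ ⁅ w ⁆) (sym g-w) v∈)
      ; along = case-∪ (λ {x} x∈ → subst (λ y → y ≡ x ⊎ E x y) (sym (g-A x∈)) (along S x∈))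
                       (subst (λ y → y ≡ w ⊎ E w y) (sym g-w) arc)
      ; token-stays = case-∪ (λ x∈ x∈T → trans (g-A x∈) (token-stays S x∈ (T⊆T′ x∈T)))
                             (λ w∈T → trans g-w (stays w∈T))
      ; shared = case-∪ at-A at-w
      }
      where
      Shared : Fin n → Set
      Shared x = g x ∈ T ⊎ ∃ λ x′ → x′ ∈ A ∪ ⁅ w ⁆ × x′ ≢ x × g x′ ≡ g x
      at-A : ∀ {x} → x ∈ A → Shared x
      at-A {x} x∈ with shared S x∈
      ... | inj₂ (x′ , x′∈ , x′≢x , eq) =
        inj₂ (x′ , old x′∈ , x′≢x , trans (g-A x′∈) (trans eq (sym (g-A x∈))))
      ... | inj₁ ∈T′ with shared-A x∈ ∈T′
      ...   | inj₁ ∈T = inj₁ (subst (_∈ T) (sym (g-A x∈)) ∈T)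
      ...   | inj₂ v≡ =
        inj₂ (w , x∈p∪⁅x⁆ A w , ∈-∉⇒≢ x∈ w∉A ∘ sym , trans g-w (trans v≡ (sym (g-A x∈))))
      at-w : Shared w
      at-w = [ (λ v∈T → inj₁ (subst (_∈ T) (sym g-w) v∈T))
             , (λ (x , x∈ , eq) → inj₂ (x , old x∈ , ∈-∉⇒≢ x∈ w∉A , trans (g-A x∈) (trans eq (sym g-w))))
             ]′ shared-w

  settled-keep : w ∈ T → Settled E T A → Settled E T (A ∪ ⁅ w ⁆)
  settled-keep w∈T S = extend-settled w S (x∈p∪⁅x⁆ A w) (inj₁ refl) (λ _ → refl) (λ z → z)
    (λ _ → inj₁) (inj₁ w∈T)

  -- The move on `A` treats `p` as a token holder, so `p` stays put, and `w` and `p` share the fibre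
  -- over `p`.
  settled-pass : ∀ {p} → w ∉ T → p ∈ A → E w p → Settled E (T ∪ ⁅ p ⁆) A → Settled E T (A ∪ ⁅ w ⁆)
  settled-pass {p} w∉T p∈A e S = extend-settled p S (old p∈A) (inj₂ e) (λ w∈T → contradiction w∈T w∉T)
    (p⊆p∪q ⁅ p ⁆) (λ _ → map₂ sym ∘ x∈p∪⁅y⁆⁻ T)
    (inj₂ (p , p∈A , token-stays S p∈A (x∈p∪⁅x⁆ T p)))

settled-⊥ : ∀ {E : Rel (Fin n) 0ℓ} {T} → Settled E T ⊥
settled-⊥ = record
  { move = λ x → x
  ; move-∈ = λ x∈ → x∈
  ; along = λ _ → inj₁ refl
  ; token-stays = λ _ _ → refl
  ; shared = λ x∈ → contradiction x∈ ∉⊥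
  }

settled-mono : ∀ {E F : Rel (Fin n) 0ℓ} {T A} → (∀ {u v} → E u v → F u v) → Settled E T A → Settled F T A
settled-mono E⇒F S = record
  { move = move S
  ; move-∈ = move-∈ S
  ; along = λ x∈ → map₂ E⇒F (along S x∈)
  ; token-stays = token-stays S
  ; shared = shared S
  }

module _ {E : Rel (Fin n) 0ℓ} {T A B : Subset n}
  (disjoint : ∀ {x} → x ∈ B → x ∉ A) (SA : Settled E T A) (SB : Settled E T B) where

  private
    g : Fin n → Fin n
    g x with x ∈? A
    ... | yes _ = move SA x
    ... | no  _ = move SB x

    g-A : ∀ {x} → x ∈ A → g x ≡ move SA x
    g-A {x} x∈A with x ∈? A
    ... | yes _ = refl
    ... | no x∉A = contradiction x∈A x∉A

    g-B : ∀ {x} → x ∈ B → g x ≡ move SB x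
    g-B {x} x∈B with x ∈? A
    ... | yes x∈A = contradiction x∈A (disjoint x∈B)
    ... | no _ = refl

    piece : ∀ {D} (S : Settled E T D) → D ⊆ A ∪ B → (∀ {x} → x ∈ D → g x ≡ move S x) → ∀ {x} → x ∈ D →
            g x ∈ A ∪ B × (g x ≡ x ⊎ E x (g x)) × (x ∈ T → g x ≡ x) ×
            (g x ∈ T ⊎ ∃ λ x′ → x′ ∈ A ∪ B × x′ ≢ x × g x′ ≡ g x)
    piece S D⊆ g≡ {x} x∈ with shared S x∈
    ... | sh rewrite g≡ x∈ = D⊆ (move-∈ S x∈) , along S x∈ , token-stays S x∈ ,
      map₂ (λ (x′ , x′∈ , x′≢x , eq) → x′ , D⊆ x′∈ , x′≢x , trans (g≡ x′∈) eq) sh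

    both : ∀ {x} → x ∈ A ∪ B → _
    both {x} x∈ = [ (λ x∈A → piece SA (p⊆p∪q B) g-A x∈A)
                  , (λ x∈B → piece SB (q⊆p∪q A B) g-B x∈B) ]′ (x∈p∪q⁻ A B x∈)

  settled-∪ : Settled E T (A ∪ B)
  settled-∪ = record
    { move = g
    ; move-∈ = proj₁ ∘ both
    ; along = proj₁ ∘ proj₂ ∘ both
    ; token-stays = proj₁ ∘ proj₂ ∘ proj₂ ∘ both
    ; shared = proj₂ ∘ proj₂ ∘ proj₂ ∘ both
    }

-- The last vertex of the tree is a leaf: it stays if it holds a token and otherwise passes one to
-- its parent. `T` is quantified after the derivation because it grows in the recursive call.
settled-grown : ∀ {E : Rel (Fin n) 0ℓ} {r A} → Grown (flip E) r A → ∀ {T} → r ∈ T → Settled E T A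
settled-grown {r = r} source {T} r∈T = record
  { move = λ x → x
  ; move-∈ = λ x∈ → x∈
  ; along = λ _ → inj₁ refl
  ; token-stays = λ _ _ → refl
  ; shared = λ x∈ → inj₁ (subst (_∈ T) (sym (x∈⁅y⁆⇒x≡y r x∈)) r∈T)
  }
settled-grown (extend {v = w} g p∈A w∉A e) {T} r∈T with w ∈? T
... | yes w∈T = settled-keep w∉A w∈T (settled-grown g r∈T)
... | no w∉T = settled-pass w∉A w∉T p∈A e (settled-grown g (p⊆p∪q _ r∈T))

-- From terminal strong components to the whole digraph

module _ {E : Rel (Fin n) 0ℓ} (E? : Decidable E)
  (branching : ∀ u a → ∃ λ t → E u t × t ≢ u × t ≢ a) where

  module _ {C : Subset n} (closed : Closed E C) (connected : ∀ {u v} → u ∈ C → v ∈ C → Star E u v) where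

    private
      E∣C : Rel (Fin n) 0ℓ
      E∣C u v = E u v × u ∈ C × v ∈ C

      E∣C? : Decidable E∣C
      E∣C? u v = E? u v ×-dec u ∈? C ×-dec v ∈? C

      restrict : ∀ {u v} → u ∈ C → Star E u v → Star E∣C u v
      restrict u∈ ε = ε
      restrict u∈ (e ◅ es) = (e , u∈ , closed u∈ e) ◅ restrict (closed u∈ e) es

      branching∣C : ∀ {u} → u ∈ C → ∀ a → ∃ λ t → E∣C u t × t ≢ u × t ≢ a
      branching∣C {u} u∈ a = let t , e , t≢ = branching u a in t , (e , u∈ , closed u∈ e) , t≢

      open Strong E∣C? C proj₂ (λ u∈ v∈ → restrict u∈ (connected u∈ v∈)) branching∣C

      grown-⊆ : ∀ {F : Rel (Fin n) 0ℓ} {r A} → Grown F r A → r ∈ C → (∀ {u v} → F u v → v ∈ C) → A ⊆ C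
      grown-⊆ g r∈ sub = grown-ind (_∈ C) g r∈ (λ _ _ _ → sub)

    -- By connectedness, a token holder in `C` is the root of an in-tree spanning `C`. Without one,
    -- a dominating arc provides an in-tree spanning all of `C` but `c`.
    settled-strong : Nonempty C → ∀ T → Settled E T C
    settled-strong C≢∅ T with any? (λ p → p ∈? C ×-dec p ∈? T)
    ... | yes (p , p∈C , p∈T) =
      subst (Settled E T) (⊆-antisym (grown-⊆ g p∈C (proj₁ ∘ proj₂))
        (λ v∈ → closed-star⁻ (reach-closed (flip E∣C?) p) (grown-source g) (restrict v∈ (connected v∈ p∈C))))
        (settled-mono proj₁ (settled-grown g p∈T))
      where
      g : Grown (flip E∣C) p (reach (flip E∣C?) p)
      g = reach-grown (flip E∣C?) p
    ... | no disjoint with dominating-arc C≢∅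
    ...   | c , r , (Ecr , c∈ , r∈) , r≢c , C⊆ =
      subst (Settled E T)
        (⊆-antisym (λ v∈ → [ grown-⊆ g r∈ (proj₁ ∘ proj₂ ∘ proj₁)
                           , (λ v≡c → subst (_∈ C) (sym v≡c) c∈) ]′ (x∈p∪⁅y⁆⁻ _ v∈)) C⊆)
        -- `c` lies off the tree, so no vertex chooses it, and it supplies the token that the root
        -- `r` needs.
        (settled-pass (λ c∈into → grown-avoids g inj₂ r≢c c∈into refl) (λ c∈T → disjoint (c , c∈ , c∈T))
          (grown-source g) Ecr (settled-mono (proj₁ ∘ proj₁) (settled-grown g (x∈p∪⁅x⁆ T r))))
      where
      g : Grown (flip (E∣C ∖ c)) r (reach (flip (∖-dec E∣C? c)) r)
      g = reach-grown (flip (∖-dec E∣C? c)) r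

  private
    -- A vertex with minimal reach set lies in a terminal strong component: moving to a `u` that
    -- cannot return to `v` removes `v` from the reach set.
    strong-reach : ∀ v → Acc _⊂_ (reach E? v) →
                   ∃ λ u → u ∈ reach E? v × (∀ {w} → w ∈ reach E? u → u ∈ reach E? w)
    strong-reach v (acc rec) with any? (λ u → u ∈? reach E? v ×-dec ¬? (v ∈? reach E? u))
    ... | yes (u , u∈ , v∉) =
      let x , x∈ , strong = strong-reach u (rec (sub , v , reach-source E? v , v∉)) in x , sub x∈ , strong
      where
      sub : reach E? u ⊆ reach E? v
      sub w∈ = closed-star (reach-closed E? v) u∈ (reach-star E? w∈)
    ... | no ¬u = v , reach-source E? v , λ {w} w∈ → back w w∈
      where
      back : ∀ w → w ∈ reach E? v → v ∈ reach E? w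
      back w w∈ with v ∈? reach E? w
      ... | yes v∈ = v∈
      ... | no v∉ = contradiction (w , w∈ , v∉) ¬u

    -- The invariant ranges over all `T`, since a vertex added later may pass a token to any vertex
    -- of `A`.
    settle-all : ∀ A → Acc (flip _⊂_) A → (∀ T → Settled E T A) →
                 ∃ λ B → (∀ v → v ∈ B) × (∀ T → Settled E T B)
    settle-all A (acc rec) S with closed? (flip E?) A
    ... | inj₁ (p , w , p∈A , w∉A , e) = settle-all _ (rec (∪⁅⁆-⊃ w∉A)) S′
      where
      S′ : ∀ T → Settled E T (A ∪ ⁅ w ⁆)
      S′ T with w ∈? T
      ... | yes w∈T = settled-keep w∉A w∈T (S T)
      ... | no w∉T = settled-pass w∉A w∉T p∈A e (S (T ∪ ⁅ p ⁆))
    ... | inj₂ cl with any? (λ v → ¬? (v ∈? A))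
    ...   | no ¬v = A , (λ v → all v) , S
      where
      all : ∀ v → v ∈ A
      all v with v ∈? A
      ... | yes v∈ = v∈
      ... | no v∉ = contradiction (v , v∉) ¬v
    -- Here `A` contains all predecessors of its vertices, so nothing reachable from `v` lies in
    -- `A`, and a terminal component reached from `v` can be added as a disjoint piece.
    ...   | yes (v , v∉A) with strong-reach v (⊂-wellFounded _)
    ...     | u , u∈ , strong =
      settle-all (A ∪ C) (rec (p⊆p∪q C , u , q⊆p∪q A C (reach-source E? u) , disjoint (reach-source E? u)))
        λ T → settled-∪ disjoint (S T) (settled-strong (reach-closed E? u)
          (λ x∈ y∈ → reach-star E? (strong x∈) ◅◅ reach-star E? y∈) (u , reach-source E? u) T)
      where
      C : Subset n
      C = reach E? u
      disjoint : ∀ {x} → x ∈ C → x ∉ A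
      disjoint x∈ x∈A = v∉A (closed-star⁻ cl x∈A (reach-star E? u∈ ◅◅ reach-star E? x∈))

  singleton-free-map : Σ (Fin n → Fin n) λ g →
    (∀ x → g x ≡ x ⊎ E x (g x)) × (∀ x → ∃ λ x′ → x′ ≢ x × g x′ ≡ g x)
  singleton-free-map with settle-all ⊥ (⊃-wellFounded _) (λ _ → settled-⊥)
  ... | B , all , S = move S⊥ , (λ x → along S⊥ (all x)) ,
    λ x → [ (λ ∈⊥ → contradiction ∈⊥ ∉⊥) , (λ (x′ , _ , rest) → x′ , rest) ]′ (shared S⊥ (all x))
    where
    S⊥ : Settled E ⊥ B
    S⊥ = S ⊥

-- Selections covering Y in a regular bipartite graph

bit : Bool → ℕ
bit true = 1
bit false = 0

sum-mono-≤ : ∀ {n} {f g : Fin n → ℕ} → (∀ i → f i ≤ g i) → sum f ≤ sum g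
sum-mono-≤ {zero} f≤g = z≤n
sum-mono-≤ {suc n} f≤g = +-mono-≤ (f≤g zero) (sum-mono-≤ (f≤g ∘ suc))

sum-mono-< : ∀ {n} {f g : Fin n → ℕ} → (∀ i → f i ≤ g i) → ∀ j → f j < g j → sum f < sum g
sum-mono-< f≤g zero lt = +-mono-<-≤ lt (sum-mono-≤ (f≤g ∘ suc))
sum-mono-< f≤g (suc j) lt = +-mono-≤-< (f≤g zero) (sum-mono-< (f≤g ∘ suc) j lt)

sum-zero : ∀ {n} {f : Fin n → ℕ} → (∀ i → f i ≡ 0) → sum f ≡ 0
sum-zero {zero} f≡0 = refl
sum-zero {suc n} f≡0 = cong₂ _+_ (f≡0 zero) (sum-zero (f≡0 ∘ suc))

δ : ∀ {n} → Fin n → Fin n → ℕ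
δ i j = bit (does (i ≟ j))

sum-δ : ∀ {n} (i : Fin n) (h : Fin n → ℕ) → sum (λ j → δ i j * h j) ≡ h i
sum-δ {suc n} zero h = trans (cong (h zero + 0 +_) (sum-zero {n} (λ _ → refl)))
  (trans (+-identityʳ _) (+-identityʳ _))
sum-δ (suc i) h = sum-δ i (h ∘ suc)

sum-δ-1 : ∀ {n} (i : Fin n) → sum (δ i) ≡ 1
sum-δ-1 i = trans (sum-cong-≗ λ j → sym (*-identityʳ (δ i j))) (sum-δ i (λ _ → 1))

countTrue-sum : ∀ {n} (p : Fin n → Bool) → countTrue p ≡ sum (bit ∘ p)
countTrue-sum p = go p (λ i → i)
  where
  -- `allFin` is `tabulate` of the identity; the induction needs an arbitrary `h`.
  go : ∀ {m n} (p : Fin m → Bool) (h : Fin n → Fin m) →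
       length (filter (λ i → T? (p i)) (tabulate h)) ≡ sum (bit ∘ p ∘ h)
  go {n = zero} p h = refl
  go {n = suc n} p h with p (h zero)
  ... | true = cong suc (go p (h ∘ suc))
  ... | false = go p (h ∘ suc)

bit-≤1 : ∀ b → bit b ≤ 1
bit-≤1 true = s≤s z≤n
bit-≤1 false = z≤n

δ-refl : ∀ {n} (i : Fin n) → δ i i ≡ 1
δ-refl i = cong bit (dec-true (i ≟ i) refl)

bit-≤ : ∀ b {k} → (T b → 1 ≤ k) → bit b ≤ k
bit-≤ true h = h _
bit-≤ false h = z≤n

sum-bit-≤1 : ∀ {n} (p : Fin n → Bool) → (∀ {i j} → T (p i) → T (p j) → i ≡ j) → sum (bit ∘ p) ≤ 1
sum-bit-≤1 p unique with any? (λ i → T? (p i))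
... | yes (i , pi) = ≤-trans
  (sum-mono-≤ λ j → bit-≤ (p j) λ pj → ≤-reflexive (sym (trans (cong (δ i) (unique pj pi)) (δ-refl i))))
  (≤-reflexive (sum-δ-1 i))
... | no ¬i = ≤-trans (≤-reflexive (sum-zero λ j → n≤0⇒n≡0 (bit-≤ (p j) λ pj → contradiction (j , pj) ¬i))) z≤n

-- If `p` held only at `a` and `b`, its indicator would be at most `δ a + δ b`, whose sum is 2.
countTrue≥3 : ∀ {n} (p : Fin n → Bool) → countTrue p ≥ 3 → ∀ a b → ∃ λ i → T (p i) × i ≢ a × i ≢ b
countTrue≥3 p ≥3 a b with any? (λ i → T? (p i) ×-dec ¬? (i ≟ a) ×-dec ¬? (i ≟ b))
... | yes found = found
... | no ¬found = contradiction (≤-trans ≥3 ≤2) λ { (s≤s (s≤s ())) }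
  where
  bound : ∀ i → bit (p i) ≤ δ a i + δ b i
  bound i = bit-≤ (p i) λ pi → at pi (i ≟ a) (i ≟ b)
    where
    at : T (p i) → Dec (i ≡ a) → Dec (i ≡ b) → 1 ≤ δ a i + δ b i
    at _ (yes refl) _ = ≤-trans (≤-reflexive (sym (δ-refl i))) (m≤m+n _ _)
    at _ (no _) (yes refl) = ≤-trans (≤-reflexive (sym (δ-refl i))) (m≤n+m _ _)
    at pi (no i≢a) (no i≢b) = contradiction (i , pi , i≢a , i≢b) ¬found
  ≤2 : countTrue p ≤ 2
  ≤2 = ≤-trans (≤-reflexive (countTrue-sum p)) (≤-trans (sum-mono-≤ bound)
    (≤-reflexive (trans (∑-distrib-+ (δ a) (δ b)) (cong₂ _+_ (sum-δ-1 a) (sum-δ-1 b)))))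

countTrue≡1-unique : ∀ {n} (p : Fin n → Bool) → countTrue p ≡ 1 → ∀ {i j} → T (p i) → T (p j) → i ≡ j
countTrue≡1-unique {n} p ≡1 {i} {j} pi pj = go (member pi) (member pj) ≡1
  where
  member : ∀ {i} → T (p i) → i ∈ₗ filter (λ i → T? (p i)) (allFin n)
  member {i} pi = ∈-filter⁺ (λ i → T? (p i)) (∈-allFin i) pi
  go : ∀ {xs} → i ∈ₗ xs → j ∈ₗ xs → length xs ≡ 1 → i ≡ j
  go {_ ∷ []} (here refl) (here refl) _ = refl

countTrue-witness : ∀ {n} (p : Fin n → Bool) → countTrue p ≥ 1 → ∃ λ i → T (p i)
countTrue-witness p ≥1 with any? (λ i → T? (p i))
... | yes found = found
... | no ¬found = contradiction (≤-trans ≥1 (≤-reflexive (trans (countTrue-sum p)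
  (sum-zero λ i → n≤0⇒n≡0 (bit-≤ (p i) λ pi → contradiction (i , pi) ¬found))))) λ ()

fromDec : ∀ {n} {P : Pred (Fin n) 0ℓ} → Decidable₁ P → Subset n
fromDec P? = Vec.tabulate (does ∘ P?)

∈-fromDec⁺ : ∀ {n} {P : Pred (Fin n) 0ℓ} (P? : Decidable₁ P) {i} → P i → i ∈ fromDec P?
∈-fromDec⁺ P? {i} pi = lookup⇒[]= i _ (trans (lookup∘tabulate (does ∘ P?) i) (dec-true (P? i) pi))

∈-fromDec⁻ : ∀ {n} {P : Pred (Fin n) 0ℓ} (P? : Decidable₁ P) {i} → i ∈ fromDec P? → P i
∈-fromDec⁻ P? {i} i∈ with P? i | trans (sym (lookup∘tabulate (does ∘ P?) i)) ([]=⇒lookup i∈)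
... | yes pi | _ = pi

-- Alternating paths and double counting

module _ {m n : ℕ} (G : BipGraph m n) where

  private
    Along : (Fin m → Fin n) → Set
    Along f = ∀ x → T (adj G x (f x))

    Covered : (Fin m → Fin n) → Fin n → Set
    Covered f y = ∃ λ x → f x ≡ y

    covered? : ∀ f → Decidable₁ (Covered f)
    covered? f y = any? λ x → f x ≟ y

    -- One step of an alternating path: `x` selects `y′` but could be reselected to `y`.
    Step : (Fin m → Fin n) → Fin n → Fin n → Set
    Step f y y′ = ∃ λ x → T (adj G x y) × f x ≡ y′

    step? : ∀ f → Decidable (Step f)
    step? f y y′ = any? λ x → T? (adj G x y) ×-dec f x ≟ y′

    record Better (f : Fin m → Fin n) : Set where
      field
        better : Fin m → Fin n
        along : Along better
        covers : ∀ {y} → Covered f y → Covered better y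
        new : Fin n
        new-covered : Covered better new
        new-uncovered : ¬ Covered f new

    -- A derivation that y is reached from the uncovered y₀ is an alternating path: reselect its edges
    -- from the doubly covered end on, until an uncovered vertex is covered. The derivation is for the
    -- original f, and reselection only touches vertices x with f x ∉ A.
    shift : ∀ {f y₀ A} → Grown (Step f) y₀ A → ∀ {f′} → Along f′ → (∀ {x} → f x ∈ A → f′ x ≡ f x) →
            ¬ Covered f′ y₀ → ∀ {x₁ x₂} → x₁ ≢ x₂ → f′ x₁ ≡ f′ x₂ → f′ x₁ ∈ A → Better f′
    shift source along agree un {x₁} _ _ fx∈ = contradiction (x₁ , x∈⁅y⁆⇒x≡y _ fx∈) un
    shift {f} {y₀} (extend {A} {p} {v} g p∈A v∉A (x , xp , fx≡v)) {f′} along agree un {x₁} {x₂} x₁≢x₂ eq fx∈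
      with x∈p∪⁅y⁆⁻ A fx∈
    ... | inj₁ ∈A = shift g along (agree ∘ p⊆p∪q ⁅ v ⁆) un x₁≢x₂ eq ∈A
    -- After reselecting `x` from `v` to `p`, the vertex `v` is still covered by `other`. Either `p`
    -- is newly covered, or it is now doubly covered and the argument recurs on the smaller set.
    ... | inj₂ f′x₁≡v = result (covered? f′ p)
      where
      f′x≡v : f′ x ≡ v
      f′x≡v = trans (agree (subst (_∈ _) (sym fx≡v) (x∈p∪⁅x⁆ A v))) fx≡v
      other : ∃ λ z → z ≢ x × f′ z ≡ v
      other with x₁ ≟ x
      ... | yes refl = x₂ , x₁≢x₂ ∘ sym , trans (sym eq) f′x₁≡v
      ... | no x₁≢x = x₁ , x₁≢x , f′x₁≡v
      f″ : Fin m → Fin n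
      f″ = redirect f′ x p
      along″ : Along f″
      along″ x′ with x′ ≟ x
      ... | yes refl = subst (T ∘ adj G x) (sym (redirect-at f′ x p)) xp
      ... | no x′≢x = subst (T ∘ adj G x′) (sym (redirect-off f′ p x′≢x)) (along x′)
      covers″ : ∀ {y} → Covered f′ y → Covered f″ y
      covers″ (x′ , refl) with x′ ≟ x
      ... | yes refl = let z , z≢x , f′z≡v = other in
                       z , trans (redirect-off f′ p z≢x) (trans f′z≡v (sym f′x≡v))
      ... | no x′≢x = x′ , redirect-off f′ p x′≢x
      agree″ : ∀ {x′} → f x′ ∈ A → f″ x′ ≡ f x′
      agree″ {x′} ∈A = trans
        (redirect-off f′ p λ x′≡x → v∉A (subst (_∈ A) (trans (cong f x′≡x) fx≡v) ∈A))
        (agree (p⊆p∪q ⁅ v ⁆ ∈A))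
      result : Dec (Covered f′ p) → Better f′
      result (no ¬cov) = record
        { better = f″ ; along = along″ ; covers = covers″
        ; new = p ; new-covered = x , redirect-at f′ x p ; new-uncovered = ¬cov }
      result (yes (x′ , f′x′≡p)) = record
        { better = B.better ; along = B.along ; covers = B.covers ∘ covers″
        ; new = B.new ; new-covered = B.new-covered ; new-uncovered = B.new-uncovered ∘ covers″ }
        where
        x′≢x : x′ ≢ x
        x′≢x refl = v∉A (subst (_∈ A) (trans (sym f′x′≡p) f′x≡v) p∈A)
        un″ : ¬ Covered f″ y₀
        un″ (z , f″z≡) with z ≟ x
        ... | yes refl = un (x′ , trans f′x′≡p (trans (sym (redirect-at f′ x p)) f″z≡))
        ... | no z≢x = un (z , trans (sym (redirect-off f′ p z≢x)) f″z≡)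
        module B = Better (shift g along″ agree″ un″ {x′} {x} x′≢x
          (trans (trans (redirect-off f′ p x′≢x) f′x′≡p) (sym (redirect-at f′ x p)))
          (subst (_∈ A) (sym (trans (redirect-off f′ p x′≢x) f′x′≡p)) p∈A))

  module _ {k : ℕ} .{{_ : NonZero k}} (regular : Regular k G) where

    private
      -- Double counting the edges at A: if f were injective on f⁻¹(A) and missed y₀, then k∣A∣ edges
      -- would end in f⁻¹(A), which has fewer than ∣A∣ vertices of degree k.
      step-closed-covered : ∀ {f y₀ A} → Closed (Step f) A → y₀ ∈ A →
        (∀ {x x′} → f x ∈ A → f x ≡ f x′ → x ≡ x′) → Covered f y₀
      step-closed-covered {f} {y₀} {A} closed y₀∈A injective with covered? f y₀
      ... | yes cov = cov
      ... | no ¬cov = contradiction (*-cancelˡ-≤ k k∣A∣≤) (<⇒≱ preimage<)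
        where
        a : Fin n → ℕ
        a y = bit (does (y ∈? A))

        fibre : Fin n → ℕ
        fibre y = sum λ x → δ (f x) y

        deg-X : ∀ x → sum (λ y → bit (adj G x y)) ≡ k
        deg-X x = trans (sym (countTrue-sum (adj G x))) (proj₁ regular x)

        deg-Y : ∀ y → sum (λ x → bit (adj G x y)) ≡ k
        deg-Y y = trans (sym (countTrue-sum (λ x → adj G x y))) (proj₂ regular y)

        -- As `A` is closed, an `x` with a neighbour in `A` has `f x ∈ A`; every other `x`
        -- contributes no edge.
        row : ∀ x → sum (λ y → a y * bit (adj G x y)) ≤ k * a (f x)
        row x with f x ∈? A
        ... | yes _ = ≤-trans (sum-mono-≤ λ y → *-monoˡ-≤ (bit (adj G x y)) (bit-≤1 (does (y ∈? A))))
              (≤-reflexive (trans (sum-cong-≗ λ y → *-identityˡ (bit (adj G x y))) (trans (deg-X x) (sym (*-identityʳ k)))))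
        ... | no fx∉ = ≤-trans (≤-reflexive (sum-zero zeros)) z≤n
          where
          zeros : ∀ y → a y * bit (adj G x y) ≡ 0
          zeros y with y ∈? A
          ... | no _ = refl
          ... | yes y∈ = n≤0⇒n≡0 (≤-trans (≤-reflexive (+-identityʳ _)) (bit-≤ (adj G x y)
                  λ xy → contradiction (closed y∈ (x , xy , refl)) fx∉))

        k∣A∣≤ : k * sum a ≤ k * sum (a ∘ f)
        k∣A∣≤ = begin
          k * sum a                                     ≡⟨ *-distribˡ-sum k a ⟩
          sum (λ y → k * a y)                           ≡⟨ sum-cong-≗ (λ y → trans (*-comm k (a y)) (cong (a y *_) (sym (deg-Y y)))) ⟩
          sum (λ y → a y * sum (λ x → bit (adj G x y))) ≡⟨ sum-cong-≗ (λ y → *-distribˡ-sum (a y) (λ x → bit (adj G x y))) ⟩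
          sum (λ y → sum (λ x → a y * bit (adj G x y))) ≡⟨ ∑-comm (λ y x → a y * bit (adj G x y)) ⟩
          sum (λ x → sum (λ y → a y * bit (adj G x y))) ≤⟨ sum-mono-≤ row ⟩
          sum (λ x → k * a (f x))                       ≡⟨ *-distribˡ-sum k (a ∘ f) ⟨
          k * sum (a ∘ f)                               ∎
          where open ≤-Reasoning

        fibre-bound : ∀ y → a y * fibre y ≤ a y
        fibre-bound y with y ∈? A
        ... | no _ = z≤n
        ... | yes y∈ = ≤-trans (≤-reflexive (+-identityʳ _)) (sum-bit-≤1 (λ x → does (f x ≟ y)) unique)
          where
          hits : ∀ {x} → T (does (f x ≟ y)) → f x ≡ y
          hits {x} t with f x ≟ y
          ... | yes e = e
          unique : ∀ {x x′} → T (does (f x ≟ y)) → T (does (f x′ ≟ y)) → x ≡ x′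
          unique t t′ = injective (subst (_∈ A) (sym (hits t)) y∈) (trans (hits t) (sym (hits t′)))

        fibre-y₀ : a y₀ * fibre y₀ < a y₀
        fibre-y₀ rewrite sum-zero {f = λ x → δ (f x) y₀} (λ x → cong bit (dec-false (f x ≟ y₀) (λ e → ¬cov (x , e))))
                       | dec-true (y₀ ∈? A) y₀∈A = s≤s z≤n

        -- The preimage of `A` is counted by fibres: each over `A` has at most one element, and the
        -- one over `y₀` is empty.
        preimage< : sum (a ∘ f) < sum a
        preimage< = begin-strict
          sum (λ x → a (f x))                      ≡⟨ sum-cong-≗ (λ x → sum-δ (f x) a) ⟨
          sum (λ x → sum (λ y → δ (f x) y * a y))  ≡⟨ ∑-comm (λ x y → δ (f x) y * a y) ⟩
          sum (λ y → sum (λ x → δ (f x) y * a y))  ≡⟨ sum-cong-≗ (λ y → sum-cong-≗ (λ x → *-comm (δ (f x) y) (a y))) ⟩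
          sum (λ y → sum (λ x → a y * δ (f x) y))  ≡⟨ sum-cong-≗ (λ y → *-distribˡ-sum (a y) (λ x → δ (f x) y)) ⟨
          sum (λ y → a y * fibre y)                <⟨ sum-mono-< fibre-bound y₀ fibre-y₀ ⟩
          sum a                                    ∎
          where open ≤-Reasoning

      -- Either an alternating path from `y₀` ends in a doubly covered vertex, or `f` is injective
      -- over the reach set and counting contradicts that `y₀` is uncovered.
      improve-cover : ∀ {f} → Along f → ∀ {y₀} → ¬ Covered f y₀ → Better f
      improve-cover {f} along {y₀} un
        with any? (λ x → any? λ x′ → ¬? (x ≟ x′) ×-dec f x ≟ f x′ ×-dec f x ∈? reach (step? f) y₀)
      ... | yes (x , x′ , x≢x′ , eq , fx∈) = shift (reach-grown (step? f) y₀) along (λ _ → refl) un x≢x′ eq fx∈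
      ... | no ¬double = contradiction
        (step-closed-covered (reach-closed (step? f) y₀) (reach-source (step? f) y₀) λ {x} {x′} → inj x x′) un
        where
        inj : ∀ x x′ → f x ∈ reach (step? f) y₀ → f x ≡ f x′ → x ≡ x′
        inj x x′ fx∈ eq with x ≟ x′
        ... | yes e = e
        ... | no x≢x′ = contradiction (x , x′ , x≢x′ , eq , fx∈) ¬double

      cover-all : ∀ f → Acc (flip _⊂_) (fromDec (covered? f)) → Along f → ∃ λ φ → Along φ × ∀ y → Covered φ y
      cover-all f (acc rec) along with any? (λ y → ¬? (covered? f y))
      ... | yes (y₀ , un) = cover-all B.better (rec
              ((λ y∈ → ∈-fromDec⁺ (covered? B.better) (B.covers (∈-fromDec⁻ (covered? f) y∈)))
              , B.new , ∈-fromDec⁺ (covered? B.better) B.new-covered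
              , λ new∈ → B.new-uncovered (∈-fromDec⁻ (covered? f) new∈))) B.along
        where module B = Better (improve-cover along un)
      ... | no ¬un = f , along , cov
        where
        cov : ∀ y → Covered f y
        cov y with covered? f y
        ... | yes c = c
        ... | no ¬c = contradiction (y , ¬c) ¬un

    surjective-selection : ∃ λ φ → (∀ x → T (adj G x (φ x))) × ∀ y → ∃ λ x → φ x ≡ y
    surjective-selection = cover-all (proj₁ ∘ nbr) (⊃-wellFounded _) (proj₂ ∘ nbr)
      where
      nbr : ∀ x → ∃ λ y → T (adj G x y)
      nbr x = countTrue-witness (adj G x) (subst (1 ≤_) (sym (proj₁ regular x)) (>-nonZero⁻¹ k))

-- The 1-anti-factor

theorem1p4 : (k m n : ℕ) → k ≥ 3 → (G : BipGraph m n) → Regular k G →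
    Σ (SpanningSubgraph G) (λ F → IsOneAntiFactor (proj₁ F))
theorem1p4 k@(suc _) m n k≥3 G regular with surjective-selection G regular
... | φ , φ-adj , φ-onto with singleton-free-map E? branching
  where
  E : Fin m → Fin m → Set
  E x x′ = T (adj G x (φ x′))
  E? : Decidable E
  E? x x′ = T? (adj G x (φ x′))
  branching : ∀ u a → ∃ λ t → E u t × t ≢ u × t ≢ a
  -- Of at least three neighbours of `u`, one differs from `φ u` and `φ a`; as `φ` is onto it is
  -- some `φ t`, and then `t` differs from `u` and `a`.
  branching u a with countTrue≥3 (adj G u) (subst (3 ≤_) (sym (proj₁ regular u)) k≥3) (φ u) (φ a)
  ... | y , uy , y≢φu , y≢φa with φ-onto y
  ...   | t , refl = t , uy , y≢φu ∘ cong φ , y≢φa ∘ cong φ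
... | g , g-arc , g-shared = (F , F⊆G) , F-X , F-Y
  where
  F : Fin m → Fin n → Bool
  F x y = does (φ (g x) ≟ y)
  F⁻ : ∀ {x y} → T (F x y) → φ (g x) ≡ y
  F⁻ {x} {y} t with φ (g x) ≟ y
  ... | yes e = e
  F⊆G : ∀ x y → T (F x y) → T (adj G x y)
  F⊆G x y t = subst (T ∘ adj G x) (F⁻ t)
    ([ (λ gx≡x → subst (T ∘ adj G x ∘ φ) (sym gx≡x) (φ-adj x)) , (λ arc → arc) ]′ (g-arc x))
  F-X : ∀ x → degX F x ≡ 1
  F-X x = trans (countTrue-sum (F x)) (sum-δ-1 (φ (g x)))
  F-Y : ∀ y → ¬ degY F y ≡ 1
  F-Y y deg≡1 with countTrue-witness (λ x → F x y) (≤-reflexive (sym deg≡1))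
  -- If `x` were the only neighbour of `y` in `F`, the other vertex `x′` in its fibre of `g` would
  -- be joined to `y` too.
  ... | x , xy with g-shared x
  ...   | x′ , x′≢x , gx′≡gx = x′≢x (countTrue≡1-unique (λ x → F x y) deg≡1
    (subst (λ z → T (does (φ z ≟ y))) (sym gx′≡gx) xy) xy)
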